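{- Let $A_1,\ldots,A_n,C\in\mathcal{L}_\mu$ ($n\ge 0$). If the sequent $A_1,\ldots,A_n\vdash C$ is provable in $\mu\mathbf{IMALL}$, then for every admissible intuitionistic $\mu$-phase model $(M,D_M,\mathcal{D},V)$, $$[\![A_1]\!]^V\cdots[\![A_n]\!]^V\subseteq[\![C]\!]^V,$$ where the empty product (case $n=0$) is $\{1\}$. In particular, if $\vdash A$ is provable in $\mu\mathbf{IMALL}$, then $A$ is true in every admissible intuitionistic $\mu$-phase model.
   Context: Syntax. Let $\mathcal{V}$ (variables) and $\mathcal{A}$ (atomic formulas) be disjoint countably infinite sets. The set $\mathcal{L}_\mu$ of formulas is generated by $$A ::= x \mid a \mid \mathbf{1} \mid \top \mid \mathbf{0} \mid A\otimes A \mid A \mathbin{\&} A \mid A\oplus A \mid A\multimap A \mid \mu x.A \mid \nu x.A \qquad (x\in\mathcal{V},\ a\in\mathcal{A}),$$ where $\mu x$ and $\nu x$ bind $x$, and $\mu x.A$, $\nu x.A$ are formulas if and only if $x$ is positive in $A$. A free occurrence of $x$ in $A$ is positive (negative) if reaching it in $A$ traverses the antecedent (left-hand side) of $\multimap$ an even (odd) number of times; $x$ is positive (negative) in $A$ if all free occurrences of $x$ in $A$ are positive (negative). In particular a variable not occurring free in $A$ is both. Formulas may contain free variables, and $\alpha$-equivalent formulas are identified. $A(F/x)$ denotes capture-avoiding substitution of $F$ for the free occurrences of $x$ in $A$. Sequent calculus. A sequent $\Gamma\vdash C$ consists of a finite multiset $\Gamma$ of formulas and exactly one formula $C$; $\Gamma,\Delta$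 denotes the multiset union (with multiplicities added), and $\vdash C$ means the antecedent is empty. A proof is a finite tree built from the following axioms and rules of $\mu\mathbf{IMALL}$ (premises $\Rightarrow$ conclusion), where $i\in\{0,1\}$: (id) $A\vdash A$; ($Cut$) $\Gamma\vdash A$ and $A,\Delta\vdash B$ $\Rightarrow$ $\Gamma,\Delta\vdash B$; ($\vdash\mathbf{1}$) $\vdash\mathbf{1}$; ($\mathbf{1}\vdash$) $\Gamma\vdash C$ $\Rightarrow$ $\mathbf{1},\Gamma\vdash C$; ($\vdash\top$) $\Gamma\vdash\top$; ($\mathbf{0}\vdash$) $\mathbf{0},\Gamma\vdash C$; ($\vdash\otimes$) $\Gamma\vdash A$ and $\Delta\vdash B$ $\Rightarrow$ $\Gamma,\Delta\vdash A\otimes B$; ($\otimes\vdash$) $A,B,\Gamma\vdash C$ $\Rightarrow$ $A\otimes B,\Gamma\vdash C$; ($\vdash\&$) $\Gamma\vdash A$ and $\Gamma\vdash B$ $\Rightarrow$ $\Gamma\vdash A\mathbin{\&}B$; ($\&\vdash$) $A_i,\Gamma\vdash C$ $\Rightarrow$ $A_0\mathbin{\&}A_1,\Gamma\vdash C$; ($\vdash\oplus$) $\Gamma\vdash A_i$ $\Rightarrow$ $\Gamma\vdash A_0\oplus A_1$; ($\oplus\vdash$) $A,\Gamma\vdash C$ and $B,\Gamma\vdash C$ $\Rightarrow$ $A\oplus B,\Gamma\vdash C$; ($\vdash\multimap$) $A,\Gamma\vdash B$ $\Rightarrow$ $\Gamma\vdash A\multimap B$; ($\multimap\vdash$) $\Gamma\vdash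 A$ and $B,\Delta\vdash C$ $\Rightarrow$ $A\multimap B,\Gamma,\Delta\vdash C$; ($\vdash\mu$) $\Gamma\vdash A(\mu x.A/x)$ $\Rightarrow$ $\Gamma\vdash\mu x.A$; ($\mu\vdash$) $A(S/x)\vdash S$ and $S,\Gamma\vdash C$ $\Rightarrow$ $\mu x.A,\Gamma\vdash C$ (any formula $S$); ($\vdash\nu$) $\Gamma\vdash S$ and $S\vdash A(S/x)$ $\Rightarrow$ $\Gamma\vdash\nu x.A$ (any formula $S$); ($\nu\vdash$) $A(\nu x.A/x),\Gamma\vdash C$ $\Rightarrow$ $\nu x.A,\Gamma\vdash C$. Phase semantics. Let $(M,\cdot,1)$ be a commutative monoid; for $X,Y\subseteq M$ put $XY=X\cdot Y=\{xy\mid x\in X,\ y\in Y\}$ and $X\multimap Y=\{y\in M\mid xy\in Y\text{ for all }x\in X\}$. A set $D_M\subseteq\wp(M)$ is a set of closed sets if (1) $\bigcap D'\in D_M$ for every $D'\subseteq D_M$ (with $\bigcap\emptyset=M$), and (2) $X\multimap Y\in D_M$ for all $X\subseteq M$ and $Y\in D_M$. Then $(M,D_M)$ is an intuitionistic phase space, and $cl(X)=\bigcap\{Y\in D_M\mid X\subseteq Y\}$. An intuitionistic $\mu$-phase model is a quadruple $(M,D_M,\mathcal{D},V)$ where $(M,D_M)$ is an intuitionistic phase space, $\mathcal{D}\subseteq D_M$, and $V:\mathcal{V}\cup\mathcal{A}\to\mathcal{D}$ (a $\mathcal{D}$-valuation). The interpretation is: $[\![p]\!]^V=V(p)$ for $p\in\mathcal{V}\cup\mathcal{A}$;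 $[\![\mathbf{1}]\!]^V=cl(\{1\})$; $[\![\top]\!]^V=M$; $[\![\mathbf{0}]\!]^V=cl(\emptyset)$; $[\![A\otimes B]\!]^V=cl([\![A]\!]^V\cdot[\![B]\!]^V)$; $[\![A\mathbin{\&}B]\!]^V=[\![A]\!]^V\cap[\![B]\!]^V$; $[\![A\oplus B]\!]^V=cl([\![A]\!]^V\cup[\![B]\!]^V)$; $[\![A\multimap B]\!]^V=[\![A]\!]^V\multimap[\![B]\!]^V$; $$[\![\mu x.A]\!]^V=\bigcap\{X\in\mathcal{D}\mid[\![A]\!]^{V[x\mapsto X]}\subseteq X\},\qquad [\![\nu x.A]\!]^V=cl\Bigl(\bigcup\{X\in\mathcal{D}\mid X\subseteq[\![A]\!]^{V[x\mapsto X]}\}\Bigr),$$ where $V[x\mapsto X]$ agrees with $V$ except that it sends $x$ to $X$. The model (and $V$) is admissible if $[\![A]\!]^V\in\mathcal{D}$ for all $A\in\mathcal{L}_\mu$. A formula $A$ is true in the model if $1\in[\![A]\!]^V$. -}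

module Defs where

open import Level using (Level; Lift; _⊔_) renaming (suc to lsuc)
open import Algebra.Bundles using (CommutativeMonoid)
open import Data.Empty using (⊥-elim)
open import Data.List.Base using (List; []; _∷_; [_]; _++_)
open import Data.List.Relation.Binary.Permutation.Propositional using (_↭_)
open import Data.Nat.Base using (ℕ; zero; suc)
open import Data.Nat.Properties using (suc-injective)
  renaming (_≟_ to _≟ℕ_)
open import Data.Product.Base
  using (Σ-syntax; ∃-syntax; _×_; _,_; proj₁; proj₂)
open import Data.Sign.Base using (Sign; opposite) renaming (+ to pos)
open import Data.Sum.Base using (_⊎_; inj₁; inj₂)
open import Data.Unit.Base using (⊤)
open import Relation.Binary.Definitions using (_Respects_)
open import Relation.Binary.PropositionalEquality
  using (_≡_; _≢_; refl; cong; sym)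
open import Relation.Nullary using (yes; no)
open import Relation.Unary using (Pred; _∈_; _⊆_; _≐_; _∪_; _∩_)
open import Relation.Unary.Polymorphic using (∅; U)

------------------------------------------------------------------------
-- Formulas
------------------------------------------------------------------------

Var : Set
Var = ℕ

Atom : Set
Atom = ℕ

infixr 7 _⊗_ _&_
infixr 6 _⊕_
infixr 5 _⊸_

-- Formulas are taken up to α-equivalence by using de Bruijn indices: in
-- μ A p and ν A p the variable 0 of A is the bound one and the variable
-- x + 1 of A is the variable x outside.  Indices that are not bound are the
-- free variables, so every A below is a formula in its own right.
--
-- The positivity proof is irrelevant, so formulas that agree up to this
-- proof are equal.

data Formula : Set
HasSign : Sign → Var → Formula → Set

data Formula where
  var         : Var → Formula
  atom        : Atom → Formula
  𝟏 ⊤′ 𝟎      : Formula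
  _⊗_ _&_ _⊕_ : Formula → Formula → Formula
  _⊸_         : Formula → Formula → Formula
  μ ν         : (A : Formula) → .(HasSign pos 0 A) → Formula

-- HasSign s x A: every free occurrence of x in A has sign s, where the sign
-- of an occurrence is pos (neg) if an even (odd) number of antecedents of ⊸
-- is traversed to reach it.

HasSign s x (var y)  = x ≡ y → s ≡ pos
HasSign s x (atom a) = ⊤
HasSign s x 𝟏        = ⊤
HasSign s x ⊤′       = ⊤
HasSign s x 𝟎        = ⊤
HasSign s x (A ⊗ B)  = HasSign s x A × HasSign s x B
HasSign s x (A & B)  = HasSign s x A × HasSign s x B
HasSign s x (A ⊕ B)  = HasSign s x A × HasSign s x B
HasSign s x (A ⊸ B)  = HasSign (opposite s) x A × HasSign s x B
HasSign s x (μ A p)  = HasSign s (suc x) A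
HasSign s x (ν A p)  = HasSign s (suc x) A

Positive : Var → Formula → Set
Positive = HasSign pos

------------------------------------------------------------------------
-- Capture-avoiding substitution
------------------------------------------------------------------------

liftʳ : (Var → Var) → Var → Var
liftʳ ρ zero    = zero
liftʳ ρ (suc x) = suc (ρ x)

rename : (Var → Var) → Formula → Formula

rename-sign : ∀ {s y} ρ A → (∀ x → ρ x ≡ y → HasSign s x A) →
              HasSign s y (rename ρ A)

liftʳ-zero : ∀ {s} ρ A → HasSign s 0 A →
             ∀ x → liftʳ ρ x ≡ 0 → HasSign s x A
liftʳ-zero ρ A h zero    _ = h
liftʳ-zero ρ A h (suc x) ()

liftʳ-suc : ∀ {s y} ρ A → (∀ x → ρ x ≡ y → HasSign s (suc x) A) →
            ∀ x → liftʳ ρ x ≡ suc y → HasSign s x A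
liftʳ-suc ρ A h zero    ()
liftʳ-suc ρ A h (suc x) e = h x (suc-injective e)

rename ρ (var x)  = var (ρ x)
rename ρ (atom a) = atom a
rename ρ 𝟏        = 𝟏
rename ρ ⊤′       = ⊤′
rename ρ 𝟎        = 𝟎
rename ρ (A ⊗ B)  = rename ρ A ⊗ rename ρ B
rename ρ (A & B)  = rename ρ A & rename ρ B
rename ρ (A ⊕ B)  = rename ρ A ⊕ rename ρ B
rename ρ (A ⊸ B)  = rename ρ A ⊸ rename ρ B
rename ρ (μ A p)  =
  μ (rename (liftʳ ρ) A) (rename-sign (liftʳ ρ) A (liftʳ-zero ρ A p))
rename ρ (ν A p)  =
  ν (rename (liftʳ ρ) A) (rename-sign (liftʳ ρ) A (liftʳ-zero ρ A p))

rename-sign ρ (var x)  h = λ e → h x (sym e) refl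
rename-sign ρ (atom a) h = _
rename-sign ρ 𝟏        h = _
rename-sign ρ ⊤′       h = _
rename-sign ρ 𝟎        h = _
rename-sign ρ (A ⊗ B)  h =
  rename-sign ρ A (λ x e → proj₁ (h x e)) , rename-sign ρ B (λ x e → proj₂ (h x e))
rename-sign ρ (A & B)  h =
  rename-sign ρ A (λ x e → proj₁ (h x e)) , rename-sign ρ B (λ x e → proj₂ (h x e))
rename-sign ρ (A ⊕ B)  h =
  rename-sign ρ A (λ x e → proj₁ (h x e)) , rename-sign ρ B (λ x e → proj₂ (h x e))
rename-sign ρ (A ⊸ B)  h =
  rename-sign ρ A (λ x e → proj₁ (h x e)) , rename-sign ρ B (λ x e → proj₂ (h x e))
rename-sign ρ (μ A p)  h = rename-sign (liftʳ ρ) A (liftʳ-suc ρ A h)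
rename-sign ρ (ν A p)  h = rename-sign (liftʳ ρ) A (liftʳ-suc ρ A h)

liftˢ : (Var → Formula) → Var → Formula
liftˢ σ zero    = var zero
liftˢ σ (suc x) = rename suc (σ x)

-- σ fixes y and introduces no other occurrence of y.
Fixes : Var → (Var → Formula) → Set
Fixes y σ = σ y ≡ var y × (∀ x → x ≢ y → ∀ s → HasSign s y (σ x))

liftˢ-zero : ∀ σ → Fixes 0 (liftˢ σ)
liftˢ-zero σ = refl , λ where
  zero    0≢0 s → ⊥-elim (0≢0 refl)
  (suc x) _   s → rename-sign suc (σ x) (λ _ ())

liftˢ-suc : ∀ {y} σ → Fixes y σ → Fixes (suc y) (liftˢ σ)
liftˢ-suc σ (e , f) = cong (rename suc) e , λ where
  zero    _   s → λ ()
  (suc x) x≢y s → rename-sign suc (σ x)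
    (λ { z refl → f x (λ x≡y → x≢y (cong suc x≡y)) s })

substitute : (Var → Formula) → Formula → Formula

substitute-sign : ∀ {s y} σ A → Fixes y σ → HasSign s y A →
                  HasSign s y (substitute σ A)

substitute σ (var x)  = σ x
substitute σ (atom a) = atom a
substitute σ 𝟏        = 𝟏
substitute σ ⊤′       = ⊤′
substitute σ 𝟎        = 𝟎
substitute σ (A ⊗ B)  = substitute σ A ⊗ substitute σ B
substitute σ (A & B)  = substitute σ A & substitute σ B
substitute σ (A ⊕ B)  = substitute σ A ⊕ substitute σ B
substitute σ (A ⊸ B)  = substitute σ A ⊸ substitute σ B
substitute σ (μ A p)  =
  μ (substitute (liftˢ σ) A) (substitute-sign (liftˢ σ) A (liftˢ-zero σ) p)
substitute σ (ν A p)  =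
  ν (substitute (liftˢ σ) A) (substitute-sign (liftˢ σ) A (liftˢ-zero σ) p)

substitute-sign {y = y} σ (var x) (e , f) h with x ≟ℕ y
... | yes refl rewrite e = h
... | no  x≢y = f x x≢y _
substitute-sign σ (atom a) f h = _
substitute-sign σ 𝟏        f h = _
substitute-sign σ ⊤′       f h = _
substitute-sign σ 𝟎        f h = _
substitute-sign σ (A ⊗ B)  f (h , k) = substitute-sign σ A f h , substitute-sign σ B f k
substitute-sign σ (A & B)  f (h , k) = substitute-sign σ A f h , substitute-sign σ B f k
substitute-sign σ (A ⊕ B)  f (h , k) = substitute-sign σ A f h , substitute-sign σ B f k
substitute-sign σ (A ⊸ B)  f (h , k) = substitute-sign σ A f h , substitute-sign σ B f k
substitute-sign σ (μ A p)  f h = substitute-sign (liftˢ σ) A (liftˢ-suc σ f) h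
substitute-sign σ (ν A p)  f h = substitute-sign (liftˢ σ) A (liftˢ-suc σ f) h

infix 8 _[0↦_]

-- A(F/x) for the variable x that a binder in front of A would bind.
_[0↦_] : Formula → Formula → Formula
A [0↦ F ] = substitute (λ { zero → F ; (suc x) → var x }) A

------------------------------------------------------------------------
-- The sequent calculus μIMALL
------------------------------------------------------------------------

infix 3 _⊢_

-- Antecedents are multisets: lists, with the rule `exchange` identifying
-- lists that are permutations of each other.

data _⊢_ : List Formula → Formula → Set where
  exchange : ∀ {Γ Δ C} → Γ ↭ Δ → Γ ⊢ C → Δ ⊢ C
  ax  : ∀ {A} → [ A ] ⊢ A
  cut : ∀ {Γ Δ A B} → Γ ⊢ A → A ∷ Δ ⊢ B → Γ ++ Δ ⊢ B
  ⊢𝟏  : [] ⊢ 𝟏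
  𝟏⊢  : ∀ {Γ C} → Γ ⊢ C → 𝟏 ∷ Γ ⊢ C
  ⊢⊤  : ∀ {Γ} → Γ ⊢ ⊤′
  𝟎⊢  : ∀ {Γ C} → 𝟎 ∷ Γ ⊢ C
  ⊢⊗  : ∀ {Γ Δ A B} → Γ ⊢ A → Δ ⊢ B → Γ ++ Δ ⊢ A ⊗ B
  ⊗⊢  : ∀ {Γ A B C} → A ∷ B ∷ Γ ⊢ C → A ⊗ B ∷ Γ ⊢ C
  ⊢&  : ∀ {Γ A B} → Γ ⊢ A → Γ ⊢ B → Γ ⊢ A & B
  &⊢₀ : ∀ {Γ A B C} → A ∷ Γ ⊢ C → A & B ∷ Γ ⊢ C
  &⊢₁ : ∀ {Γ A B C} → B ∷ Γ ⊢ C → A & B ∷ Γ ⊢ C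
  ⊢⊕₀ : ∀ {Γ A B} → Γ ⊢ A → Γ ⊢ A ⊕ B
  ⊢⊕₁ : ∀ {Γ A B} → Γ ⊢ B → Γ ⊢ A ⊕ B
  ⊕⊢  : ∀ {Γ A B C} → A ∷ Γ ⊢ C → B ∷ Γ ⊢ C → A ⊕ B ∷ Γ ⊢ C
  ⊢⊸  : ∀ {Γ A B} → A ∷ Γ ⊢ B → Γ ⊢ A ⊸ B
  ⊸⊢  : ∀ {Γ Δ A B C} → Γ ⊢ A → B ∷ Δ ⊢ C → (A ⊸ B) ∷ Γ ++ Δ ⊢ C
  ⊢μ  : ∀ {Γ A} .{p : Positive 0 A} →
        Γ ⊢ A [0↦ μ A p ] → Γ ⊢ μ A p
  μ⊢  : ∀ {Γ A C} .{p : Positive 0 A} (S : Formula) →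
        [ A [0↦ S ] ] ⊢ S → S ∷ Γ ⊢ C → μ A p ∷ Γ ⊢ C
  ⊢ν  : ∀ {Γ A} .{p : Positive 0 A} (S : Formula) →
        Γ ⊢ S → [ S ] ⊢ A [0↦ S ] → Γ ⊢ ν A p
  ν⊢  : ∀ {Γ A C} .{p : Positive 0 A} →
        A [0↦ ν A p ] ∷ Γ ⊢ C → ν A p ∷ Γ ⊢ C

------------------------------------------------------------------------
-- Intersections and unions of sets of subsets
------------------------------------------------------------------------

⋂ : ∀ {a ℓ b} {A : Set a} → Pred (Pred A ℓ) b → Pred A (a ⊔ lsuc ℓ ⊔ b)
⋂ 𝒳 m = ∀ X → X ∈ 𝒳 → m ∈ X

⋃ : ∀ {a ℓ b} {A : Set a} → Pred (Pred A ℓ) b → Pred A (a ⊔ lsuc ℓ ⊔ b)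
⋃ 𝒳 m = ∃[ X ] X ∈ 𝒳 × m ∈ X

infix 4 _∈≐_

-- The subset Z belongs to 𝒳.  Here Z may live in a larger universe than the
-- members of 𝒳, as an intersection over a set of subsets does.
_∈≐_ : ∀ {a ℓ b c} {A : Set a} → Pred A c → Pred (Pred A ℓ) b →
       Set (a ⊔ lsuc ℓ ⊔ b ⊔ c)
Z ∈≐ 𝒳 = ∃[ X ] X ∈ 𝒳 × Z ≐ X

------------------------------------------------------------------------
-- Phase spaces
------------------------------------------------------------------------

-- The monoid is a set with an equivalence ≈ as its equality.

module Subsets {ℓ} (M : CommutativeMonoid ℓ ℓ) where
  open CommutativeMonoid M

  infixr 7 _·_
  infixr 6 _⊸ˢ_

  ｛1｝ : Pred Carrier ℓ
  ｛1｝ m = m ≈ ε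

  _·_ : ∀ {a b} → Pred Carrier a → Pred Carrier b → Pred Carrier (ℓ ⊔ a ⊔ b)
  (X · Y) z = ∃[ x ] ∃[ y ] x ∈ X × y ∈ Y × z ≈ x ∙ y

  _⊸ˢ_ : ∀ {a b} → Pred Carrier a → Pred Carrier b → Pred Carrier (ℓ ⊔ a ⊔ b)
  (X ⊸ˢ Y) y = ∀ x → x ∈ X → x ∙ y ∈ Y

  -- Members of D are subsets of the setoid, hence respect ≈ (resp-≈), and D
  -- is a set of subsets, hence respects extensional equality (resp-≐).  For
  -- ⊸-closed it makes no difference whether X is asked to respect ≈, since
  -- X ⊸ˢ Y is unchanged when X is saturated under ≈.
  record IsSetOfClosedSets (D : Pred (Pred Carrier ℓ) (lsuc ℓ)) : Set (lsuc (lsuc ℓ)) where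
    field
      resp-≈   : ∀ {X} → X ∈ D → X Respects _≈_
      resp-≐   : D Respects _≐_
      ⋂-closed : ∀ (D′ : Pred (Pred Carrier ℓ) (lsuc ℓ)) → D′ ⊆ D → ⋂ D′ ∈≐ D
      ⊸-closed : ∀ (X : Pred Carrier ℓ) {Y} → Y ∈ D → (X ⊸ˢ Y) ∈ D

record PhaseSpace (ℓ : Level) : Set (lsuc (lsuc ℓ)) where
  field
    M                 : CommutativeMonoid ℓ ℓ
    D                 : Pred (Pred (CommutativeMonoid.Carrier M) ℓ) (lsuc ℓ)
    isSetOfClosedSets : Subsets.IsSetOfClosedSets M D

  open CommutativeMonoid M public using (Carrier; _≈_; _∙_; ε)
  open Subsets M public
  open IsSetOfClosedSets isSetOfClosedSets public

  cl : ∀ {a} → Pred Carrier a → Pred Carrier (lsuc ℓ ⊔ a)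
  cl X = ⋂ (λ Y → Y ∈ D × X ⊆ Y)

------------------------------------------------------------------------
-- μ-phase models
------------------------------------------------------------------------

module Interpretation {ℓ} (P : PhaseSpace ℓ)
                      (𝒟 : Pred (Pred (PhaseSpace.Carrier P) ℓ) (lsuc ℓ)) where
  open PhaseSpace P

  Valuation : Set (lsuc ℓ)
  Valuation = Var ⊎ Atom → Σ[ X ∈ Pred Carrier ℓ ] X ∈ 𝒟

  infix 8 _[0↦_]ᵛ

  -- V[x ↦ X] for the variable x bound by a binder.
  _[0↦_]ᵛ : Valuation → (Σ[ X ∈ Pred Carrier ℓ ] X ∈ 𝒟) → Valuation
  (V [0↦ X ]ᵛ) (inj₁ zero)    = X
  (V [0↦ X ]ᵛ) (inj₁ (suc x)) = V (inj₁ x)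
  (V [0↦ X ]ᵛ) (inj₂ a)       = V (inj₂ a)

  -- Interpretations live one universe above the subsets that ⋂ ranges over.
  ⟦_⟧ : Formula → Valuation → Pred Carrier (lsuc ℓ)
  ⟦ var x ⟧  V m = Lift (lsuc ℓ) (m ∈ proj₁ (V (inj₁ x)))
  ⟦ atom a ⟧ V m = Lift (lsuc ℓ) (m ∈ proj₁ (V (inj₂ a)))
  ⟦ 𝟏 ⟧      V   = cl ｛1｝
  ⟦ ⊤′ ⟧     V   = U
  ⟦ 𝟎 ⟧      V   = cl {ℓ} ∅
  ⟦ A ⊗ B ⟧  V   = cl (⟦ A ⟧ V · ⟦ B ⟧ V)
  ⟦ A & B ⟧  V   = ⟦ A ⟧ V ∩ ⟦ B ⟧ V
  ⟦ A ⊕ B ⟧  V   = cl (⟦ A ⟧ V ∪ ⟦ B ⟧ V)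
  ⟦ A ⊸ B ⟧  V   = ⟦ A ⟧ V ⊸ˢ ⟦ B ⟧ V
  ⟦ μ A p ⟧  V   =
    ⋂ (λ X → Σ[ X∈𝒟 ∈ X ∈ 𝒟 ] ⟦ A ⟧ (V [0↦ X , X∈𝒟 ]ᵛ) ⊆ X)
  ⟦ ν A p ⟧  V   =
    cl (⋃ (λ X → Σ[ X∈𝒟 ∈ X ∈ 𝒟 ] X ⊆ ⟦ A ⟧ (V [0↦ X , X∈𝒟 ]ᵛ)))

  ⟦_⟧* : List Formula → Valuation → Pred Carrier (lsuc ℓ)
  ⟦ [] ⟧*    V m = Lift (lsuc ℓ) (m ∈ ｛1｝)
  ⟦ A ∷ Γ ⟧* V   = ⟦ A ⟧ V · ⟦ Γ ⟧* V

record μPhaseModel (ℓ : Level) : Set (lsuc (lsuc ℓ)) where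
  field
    phaseSpace : PhaseSpace ℓ

  open PhaseSpace phaseSpace public

  field
    𝒟        : Pred (Pred Carrier ℓ) (lsuc ℓ)
    𝒟-resp-≐ : 𝒟 Respects _≐_
    𝒟⊆D      : 𝒟 ⊆ D

  open Interpretation phaseSpace 𝒟 public

  field
    V : Valuation

  Admissible : Set (lsuc ℓ)
  Admissible = ∀ A → ⟦ A ⟧ V ∈≐ 𝒟

  True : Formula → Set (lsuc ℓ)
  True A = ε ∈ ⟦ A ⟧ V

{-# OPTIONS --safe #-}

-- Interpretations are closed, so a rule with a closure in the antecedent may
-- be checked on generators: {γ} ⊸ Z is closed whenever Z is.  In the rules for
-- fixed points admissibility makes the interpretation of the formula
-- substituted for the bound variable a legitimate value of that variable;
-- the rest is the Knaster–Tarski argument.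

module Submission where

open import Defs
open import Algebra.Bundles using (CommutativeMonoid)
open import Level using (Level; Lift; lift; lower; _⊔_) renaming (suc to lsuc)
open import Data.List.Base using (List; []; _∷_; [_]; _++_)
open import Data.List.Relation.Binary.Permutation.Propositional as Perm using (_↭_)
open import Data.Nat.Base using (zero; suc)
open import Data.Nat.Properties using () renaming (_≟_ to _≟ℕ_)
open import Data.Product.Base using (Σ-syntax; _×_; _,_; proj₁; proj₂)
open import Data.Sign.Base using (Sign; opposite) renaming (+ to pos; - to neg)
open import Data.Sign.Properties using (_≟_)
open import Data.Sum.Base as Sum using (_⊎_; inj₁; inj₂)
open import Data.Unit.Base using (tt)
open import Function.Base using (id; _∘_)
open import Relation.Binary.Definitions using (_Respects_)
open import Relation.Binary.PropositionalEquality using (refl)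
open import Relation.Nullary using (Dec; yes; recompute; _×-dec_; _→-dec_)
open import Relation.Unary using (Pred; _∈_; _⊆_; _≐_; _∪_; _∩_)
open import Relation.Unary.Polymorphic using (∅; U)
open import Relation.Unary.Properties using (≐-refl; ≐-sym; ≐-trans)

-- The positivity proofs inside `μ` and `ν` are irrelevant; decidability lets `recompute` turn one
-- into a proof that monotonicity can use.
hasSign? : ∀ s x A → Dec (HasSign s x A)
hasSign? s x (var y)  = (x ≟ℕ y) →-dec (s ≟ pos)
hasSign? s x (atom a) = yes tt
hasSign? s x 𝟏        = yes tt
hasSign? s x ⊤′       = yes tt
hasSign? s x 𝟎        = yes tt
hasSign? s x (A ⊗ B)  = hasSign? s x A ×-dec hasSign? s x B
hasSign? s x (A & B)  = hasSign? s x A ×-dec hasSign? s x B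
hasSign? s x (A ⊕ B)  = hasSign? s x A ×-dec hasSign? s x B
hasSign? s x (A ⊸ B)  = hasSign? (opposite s) x A ×-dec hasSign? s x B
hasSign? s x (μ A p)  = hasSign? s (suc x) A
hasSign? s x (ν A p)  = hasSign? s (suc x) A

Order : ∀ {a ℓ} {A : Set a} → Sign → Pred A ℓ → Pred A ℓ → Set (a ⊔ ℓ)
Order pos X Y = X ⊆ Y
Order neg X Y = Y ⊆ X

order-refl : ∀ {a ℓ} {A : Set a} s (X : Pred A ℓ) → Order s X X
order-refl pos X = id
order-refl neg X = id

module Semantics {ℓ} (𝓜 : μPhaseModel ℓ) where
  open μPhaseModel 𝓜
  module M = CommutativeMonoid M
  open import Algebra.Properties.CommutativeSemigroup M.commutativeSemigroup
    using (x∙yz≈y∙xz)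

  private
    variable
      a b c : Level
      X X′ : Pred Carrier a
      Y Y′ : Pred Carrier b
      Z    : Pred Carrier c

  Value : Set (lsuc ℓ)
  Value = Σ[ X ∈ Pred Carrier ℓ ] X ∈ 𝒟

  Closed : Pred Carrier a → Set (lsuc ℓ ⊔ a)
  Closed X = X ∈≐ D

  -- The clauses interpreting `μ` and `ν`, with the body abstracted to a function, so that
  -- monotonicity and congruence are proved once for every body.
  lfp gfp : (Value → Pred Carrier (lsuc ℓ)) → Pred Carrier (lsuc ℓ)
  lfp F = ⋂ (λ X → Σ[ X∈𝒟 ∈ X ∈ 𝒟 ] F (X , X∈𝒟) ⊆ X)
  gfp F = cl (⋃ (λ X → Σ[ X∈𝒟 ∈ X ∈ 𝒟 ] X ⊆ F (X , X∈𝒟)))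

  -- Monotonicity and congruence of the operations on subsets.

  cl-mono : X ⊆ X′ → cl X ⊆ cl X′
  cl-mono f m∈ Y (Y∈D , X′⊆Y) = m∈ Y (Y∈D , λ x∈X → X′⊆Y (f x∈X))

  ·-mono : X ⊆ X′ → Y ⊆ Y′ → X · Y ⊆ X′ · Y′
  ·-mono f g (x , y , x∈X , y∈Y , e) = x , y , f x∈X , g y∈Y , e

  lfp-mono : ∀ {F G} → (∀ X → F X ⊆ G X) → lfp F ⊆ lfp G
  lfp-mono f m∈ X (X∈𝒟 , GX⊆X) = m∈ X (X∈𝒟 , λ y∈ → GX⊆X (f _ y∈))

  gfp-mono : ∀ {F G} → (∀ X → F X ⊆ G X) → gfp F ⊆ gfp G
  gfp-mono f = cl-mono λ where
    (X , (X∈𝒟 , X⊆FX) , m∈X) → X , (X∈𝒟 , λ x∈X → f _ (X⊆FX x∈X)) , m∈X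

  cl-cong : X ≐ X′ → cl X ≐ cl X′
  cl-cong (f , g) = cl-mono f , cl-mono g

  ·-cong : X ≐ X′ → Y ≐ Y′ → X · Y ≐ X′ · Y′
  ·-cong (f , f′) (g , g′) = ·-mono f g , ·-mono f′ g′

  ⊸-cong : X ≐ X′ → Y ≐ Y′ → X ⊸ˢ Y ≐ X′ ⊸ˢ Y′
  ⊸-cong (f , f′) (g , g′) =
    (λ h x x∈ → g (h x (f′ x∈))) , λ h x x∈ → g′ (h x (f x∈))

  ∩-cong : X ≐ X′ → Y ≐ Y′ → X ∩ Y ≐ X′ ∩ Y′
  ∩-cong (f , f′) (g , g′) =
    (λ (x∈X , x∈Y) → f x∈X , g x∈Y) , λ (x∈X , x∈Y) → f′ x∈X , g′ x∈Y

  ∪-cong : X ≐ X′ → Y ≐ Y′ → X ∪ Y ≐ X′ ∪ Y′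
  ∪-cong (f , f′) (g , g′) = Sum.map f g , Sum.map f′ g′

  lfp-cong : ∀ {F G} → (∀ X → F X ≐ G X) → lfp F ≐ lfp G
  lfp-cong f = lfp-mono (proj₁ ∘ f) , lfp-mono (proj₂ ∘ f)

  gfp-cong : ∀ {F G} → (∀ X → F X ≐ G X) → gfp F ≐ gfp G
  gfp-cong f = gfp-mono (proj₁ ∘ f) , gfp-mono (proj₂ ∘ f)

  -- Closure and closed sets.

  ⊆-cl : X ⊆ cl X
  ⊆-cl x∈X Y (Y∈D , X⊆Y) = X⊆Y x∈X

  cl-least : Closed Z → X ⊆ Z → cl X ⊆ Z
  cl-least (Y , Y∈D , Z⊆Y , Y⊆Z) X⊆Z m∈ = Y⊆Z (m∈ Y (Y∈D , λ x∈X → Z⊆Y (X⊆Z x∈X)))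

  closed-resp-≐ : X ≐ Y → Closed Y → Closed X
  closed-resp-≐ X≐Y (Z , Z∈D , Y≐Z) = Z , Z∈D , ≐-trans X≐Y Y≐Z

  closed-resp-≈ : Closed X → X Respects _≈_
  closed-resp-≈ (Y , Y∈D , X⊆Y , Y⊆X) e m∈ = Y⊆X (resp-≈ Y∈D e (X⊆Y m∈))

  cl-closed : (X : Pred Carrier (lsuc ℓ)) → Closed (cl X)
  cl-closed X = ⋂-closed _ proj₁

  U-closed : Closed {lsuc ℓ} U
  U-closed = closed-resp-≐ ((λ _ _ ()) , _) (⋂-closed ∅ λ ())

  ∩-closed : Closed X → Closed Y → Closed (X ∩ Y)
  ∩-closed {X = X} {Y = Y} (X′ , X′∈D , X⊆X′ , X′⊆X) (Y′ , Y′∈D , Y⊆Y′ , Y′⊆Y) =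
    closed-resp-≐
      ( (λ { (x∈X , x∈Y) Z (inj₁ Z≐) → proj₂ (lower Z≐) (X⊆X′ x∈X)
           ; (x∈X , x∈Y) Z (inj₂ Z≐) → proj₂ (lower Z≐) (Y⊆Y′ x∈Y) })
      , (λ m∈ → X′⊆X (m∈ X′ (inj₁ (lift ≐-refl))) , Y′⊆Y (m∈ Y′ (inj₂ (lift ≐-refl)))))
      -- The two-element family is taken up to `≐`, so `resp-≐` puts its members in `D`; `Lift`
      -- raises it to the level that `⋂-closed` expects.
      (⋂-closed (λ Z → Lift (lsuc ℓ) (Z ≐ X′) ⊎ Lift (lsuc ℓ) (Z ≐ Y′)) λ where
        (inj₁ Z≐) → resp-≐ (≐-sym (lower Z≐)) X′∈D
        (inj₂ Z≐) → resp-≐ (≐-sym (lower Z≐)) Y′∈D)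

  -- ⊸-closed only applies to antecedents at the level of the model.
  ⊸-closed≐ : Closed X → Closed Y → Closed (X ⊸ˢ Y)
  ⊸-closed≐ (X′ , _ , X≐X′) (Y′ , Y′∈D , Y≐Y′) =
    X′ ⊸ˢ Y′ , ⊸-closed X′ Y′∈D , ⊸-cong X≐X′ Y≐Y′

  -- `x ∙ m ∈ Z` says that `x` lies in {m} ⊸ Z, which is closed; so it contains `cl X` once it
  -- contains `X`. In the left rules `m` comes from the remaining antecedent and `Z` is the
  -- succedent.
  cl-∙-least : Closed Z → ∀ m → (∀ {x} → x ∈ X → x ∙ m ∈ Z) → ∀ {x} → x ∈ cl X → x ∙ m ∈ Z
  cl-∙-least {X = X} Z-closed@(Z′ , Z′∈D , Z⊆Z′ , Z′⊆Z) m h {x} x∈ =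
    Z-resp (M.comm m x) (Z′⊆Z (cl-least (_ , m⊸Z′∈D , ≐-refl) X⊆m⊸Z′ x∈ m M.refl))
    where
    Z-resp = closed-resp-≈ Z-closed
    m⊸Z′∈D = ⊸-closed (_≈ m) Z′∈D
    X⊆m⊸Z′ : X ⊆ ((_≈ m) ⊸ˢ Z′)
    X⊆m⊸Z′ {y} y∈X n n≈m =
      Z⊆Z′ (Z-resp (M.trans (M.comm y m) (M.∙-congʳ (M.sym n≈m))) (h y∈X))

  -- This holds for every valuation, admissible or not: a least fixed point is an intersection of
  -- members of `𝒟`, hence of `D`, and a greatest one is a closure.
  ⟦⟧-closed : ∀ A W → Closed (⟦ A ⟧ W)
  ⟦⟧-closed (var x)  W = proj₁ (W (inj₁ x)) , 𝒟⊆D (proj₂ (W (inj₁ x))) , lower , lift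
  ⟦⟧-closed (atom a) W = proj₁ (W (inj₂ a)) , 𝒟⊆D (proj₂ (W (inj₂ a))) , lower , lift
  ⟦⟧-closed 𝟏        W =
    closed-resp-≐ (cl-cong (lift , lower)) (cl-closed (λ m → Lift (lsuc ℓ) (m ≈ ε)))
  ⟦⟧-closed ⊤′       W = U-closed
  ⟦⟧-closed 𝟎        W = closed-resp-≐ (cl-cong ((λ ()) , (λ ()))) (cl-closed ∅)
  ⟦⟧-closed (A ⊗ B)  W = cl-closed _
  ⟦⟧-closed (A & B)  W = ∩-closed (⟦⟧-closed A W) (⟦⟧-closed B W)
  ⟦⟧-closed (A ⊕ B)  W = cl-closed _
  ⟦⟧-closed (A ⊸ B)  W = ⊸-closed≐ (⟦⟧-closed A W) (⟦⟧-closed B W)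
  ⟦⟧-closed (μ A p)  W = ⋂-closed _ (𝒟⊆D ∘ proj₁)
  ⟦⟧-closed (ν A p)  W = cl-closed _

  ⟦⟧-resp-≈ : ∀ A W → ⟦ A ⟧ W Respects _≈_
  ⟦⟧-resp-≈ A W = closed-resp-≈ (⟦⟧-closed A W)

  -- Monotonicity of the interpretation, by signs.

  -- W x ⊆ W′ x may fail only if x is negative in A, and W′ x ⊆ W x only if x
  -- is positive in A.
  record Below (A : Formula) (W W′ : Valuation) : Set (lsuc ℓ) where
    constructor below
    field
      vars  : ∀ x s → HasSign s x A ⊎
              Order (opposite s) (proj₁ (W (inj₁ x))) (proj₁ (W′ (inj₁ x)))
      atoms : ∀ a → proj₁ (W (inj₂ a)) ≐ proj₁ (W′ (inj₂ a))

  below-map : ∀ {A B W W′} → (∀ {x s} → HasSign s x A → HasSign s x B) →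
              Below A W W′ → Below B W W′
  below-map f (below h k) = below (λ x s → Sum.map₁ f (h x s)) k

  -- An antecedent flips every sign; exchanging the valuations reverses every inclusion, and the two
  -- changes cancel.
  below-antecedent : ∀ {A B W W′} → Below (A ⊸ B) W W′ → Below A W′ W
  below-antecedent {A} {B} {W} {W′} (below h k) = below h′ (≐-sym ∘ k)
    where
    h′ : ∀ x s → HasSign s x A ⊎ Order (opposite s) (proj₁ (W′ (inj₁ x))) (proj₁ (W (inj₁ x)))
    h′ x pos = Sum.map₁ proj₁ (h x neg)
    h′ x neg = Sum.map₁ proj₁ (h x pos)

  below-bind : ∀ {A B W W′} X → (∀ {x s} → HasSign s x B → HasSign s (suc x) A) →
               Below B W W′ → Below A (W [0↦ X ]ᵛ) (W′ [0↦ X ]ᵛ)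
  below-bind X f (below h k) = below
    -- Both valuations give the bound variable the same value, so either inclusion holds whatever
    -- its sign.
    (λ { zero    s → inj₂ (order-refl (opposite s) (proj₁ X))
       ; (suc x) s → Sum.map₁ f (h x s) }) k

  ⟦⟧-mono : ∀ A {W W′} → Below A W W′ → ⟦ A ⟧ W ⊆ ⟦ A ⟧ W′
  ⟦⟧-mono (var x) (below h _) (lift m∈) with h x neg
  -- A variable is not negative in itself, so only the inclusion remains.
  ... | inj₁ neg≡pos with () ← neg≡pos refl
  ... | inj₂ f = lift (f m∈)
  ⟦⟧-mono (atom a) (below _ k) (lift m∈) = lift (proj₁ (k a) m∈)
  ⟦⟧-mono 𝟏       h = id
  ⟦⟧-mono ⊤′      h = id
  ⟦⟧-mono 𝟎       h = id
  ⟦⟧-mono (A ⊗ B) h =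
    cl-mono (·-mono (⟦⟧-mono A (below-map proj₁ h)) (⟦⟧-mono B (below-map proj₂ h)))
  ⟦⟧-mono (A & B) h (m∈A , m∈B) =
    ⟦⟧-mono A (below-map proj₁ h) m∈A , ⟦⟧-mono B (below-map proj₂ h) m∈B
  ⟦⟧-mono (A ⊕ B) h = cl-mono
    (Sum.map (⟦⟧-mono A (below-map proj₁ h)) (⟦⟧-mono B (below-map proj₂ h)))
  ⟦⟧-mono (A ⊸ B) h m∈ x x∈ =
    ⟦⟧-mono B (below-map proj₂ h) (m∈ x (⟦⟧-mono A (below-antecedent h) x∈))
  ⟦⟧-mono (μ A p) h = lfp-mono λ X → ⟦⟧-mono A (below-bind X id h)
  ⟦⟧-mono (ν A p) h = gfp-mono λ X → ⟦⟧-mono A (below-bind X id h)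

  ⟦⟧-mono₀ : ∀ A → .(Positive 0 A) → ∀ W X Y → proj₁ X ⊆ proj₁ Y →
             ⟦ A ⟧ (W [0↦ X ]ᵛ) ⊆ ⟦ A ⟧ (W [0↦ Y ]ᵛ)
  ⟦⟧-mono₀ A p W X Y X⊆Y = ⟦⟧-mono A (below
    (λ { zero    pos → inj₁ (recompute (hasSign? pos 0 A) p)
       ; zero    neg → inj₂ X⊆Y
       ; (suc x) s   → inj₂ (order-refl (opposite s) (proj₁ (W (inj₁ x)))) })
    λ _ → ≐-refl)

  -- Substitution as change of valuation.

  Realizes : (Var → Formula) → Valuation → Valuation → Set (lsuc ℓ)
  Realizes σ W W′ =
    (∀ x → ⟦ σ x ⟧ W ≐ ⟦ var x ⟧ W′) × (∀ a → ⟦ atom a ⟧ W ≐ ⟦ atom a ⟧ W′)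

  realizes-liftʳ : ∀ {ρ W W′} X → Realizes (var ∘ ρ) W W′ →
                   Realizes (var ∘ liftʳ ρ) (W [0↦ X ]ᵛ) (W′ [0↦ X ]ᵛ)
  realizes-liftʳ X (h , k) = (λ { zero → ≐-refl ; (suc x) → h x }) , k

  ⟦rename⟧ : ∀ ρ A {W W′} → Realizes (var ∘ ρ) W W′ → ⟦ rename ρ A ⟧ W ≐ ⟦ A ⟧ W′
  ⟦rename⟧ ρ (var x)  h = proj₁ h x
  ⟦rename⟧ ρ (atom a) h = proj₂ h a
  ⟦rename⟧ ρ 𝟏        h = ≐-refl
  ⟦rename⟧ ρ ⊤′       h = ≐-refl
  ⟦rename⟧ ρ 𝟎        h = ≐-refl
  ⟦rename⟧ ρ (A ⊗ B)  h = cl-cong (·-cong (⟦rename⟧ ρ A h) (⟦rename⟧ ρ B h))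
  ⟦rename⟧ ρ (A & B)  h = ∩-cong (⟦rename⟧ ρ A h) (⟦rename⟧ ρ B h)
  ⟦rename⟧ ρ (A ⊕ B)  h = cl-cong (∪-cong (⟦rename⟧ ρ A h) (⟦rename⟧ ρ B h))
  ⟦rename⟧ ρ (A ⊸ B)  h = ⊸-cong (⟦rename⟧ ρ A h) (⟦rename⟧ ρ B h)
  ⟦rename⟧ ρ (μ A p)  h = lfp-cong λ X → ⟦rename⟧ (liftʳ ρ) A (realizes-liftʳ X h)
  ⟦rename⟧ ρ (ν A p)  h = gfp-cong λ X → ⟦rename⟧ (liftʳ ρ) A (realizes-liftʳ X h)

  realizes-liftˢ : ∀ {σ W W′} X → Realizes σ W W′ →
                   Realizes (liftˢ σ) (W [0↦ X ]ᵛ) (W′ [0↦ X ]ᵛ)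
  realizes-liftˢ {σ} {W} {W′} X (h , k) = h′ , k
    where
    h′ : ∀ x → ⟦ liftˢ σ x ⟧ (W [0↦ X ]ᵛ) ≐ ⟦ var x ⟧ (W′ [0↦ X ]ᵛ)
    h′ zero    = ≐-refl
    -- `liftˢ` weakens `σ x` past the new variable, whose value `X` it cannot see; this is why
    -- renamings come first.
    h′ (suc x) = ≐-trans (⟦rename⟧ suc (σ x) ((λ _ → ≐-refl) , λ _ → ≐-refl)) (h x)

  ⟦substitute⟧ : ∀ σ A {W W′} → Realizes σ W W′ → ⟦ substitute σ A ⟧ W ≐ ⟦ A ⟧ W′
  ⟦substitute⟧ σ (var x)  h = proj₁ h x
  ⟦substitute⟧ σ (atom a) h = proj₂ h a
  ⟦substitute⟧ σ 𝟏        h = ≐-refl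
  ⟦substitute⟧ σ ⊤′       h = ≐-refl
  ⟦substitute⟧ σ 𝟎        h = ≐-refl
  ⟦substitute⟧ σ (A ⊗ B)  h = cl-cong (·-cong (⟦substitute⟧ σ A h) (⟦substitute⟧ σ B h))
  ⟦substitute⟧ σ (A & B)  h = ∩-cong (⟦substitute⟧ σ A h) (⟦substitute⟧ σ B h)
  ⟦substitute⟧ σ (A ⊕ B)  h = cl-cong (∪-cong (⟦substitute⟧ σ A h) (⟦substitute⟧ σ B h))
  ⟦substitute⟧ σ (A ⊸ B)  h = ⊸-cong (⟦substitute⟧ σ A h) (⟦substitute⟧ σ B h)
  ⟦substitute⟧ σ (μ A p)  h = lfp-cong λ X → ⟦substitute⟧ (liftˢ σ) A (realizes-liftˢ X h)
  ⟦substitute⟧ σ (ν A p)  h = gfp-cong λ X → ⟦substitute⟧ (liftˢ σ) A (realizes-liftˢ X h)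

  -- `⟦ F ⟧ W` lives one universe above the members of `𝒟`, so an extensionally equal value `X`
  -- stands in for it.
  ⟦[0↦]⟧ : ∀ A F W X → ⟦ F ⟧ W ≐ proj₁ X → ⟦ A [0↦ F ] ⟧ W ≐ ⟦ A ⟧ (W [0↦ X ]ᵛ)
  ⟦[0↦]⟧ A F W X (f , g) = ⟦substitute⟧ _ A
    ((λ { zero → (lift ∘ f) , (g ∘ lower) ; (suc x) → ≐-refl }) , λ _ → ≐-refl)

  -- Antecedents as products.

  ⟦⟧*-resp-≈ : ∀ Γ W → ⟦ Γ ⟧* W Respects _≈_
  ⟦⟧*-resp-≈ []      W e (lift m≈ε) = lift (M.trans (M.sym e) m≈ε)
  ⟦⟧*-resp-≈ (A ∷ Γ) W e (x , y , x∈ , y∈ , m≈) = x , y , x∈ , y∈ , M.trans (M.sym e) m≈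

  ⟦++⟧* : ∀ Γ Δ W → ⟦ Γ ++ Δ ⟧* W ⊆ ⟦ Γ ⟧* W · ⟦ Δ ⟧* W
  ⟦++⟧* []      Δ W {m} m∈ = ε , m , lift M.refl , m∈ , M.sym (M.identityˡ m)
  ⟦++⟧* (A ∷ Γ) Δ W (x , y , x∈ , y∈ , m≈) with ⟦++⟧* Γ Δ W y∈
  ... | g , d , g∈ , d∈ , y≈ =
    x ∙ g , d , (x , g , x∈ , g∈ , M.refl) , d∈ ,
    M.trans m≈ (M.trans (M.∙-congˡ y≈) (M.sym (M.assoc x g d)))

  ⟦⟧*-↭ : ∀ {Γ Δ} W → Γ ↭ Δ → ⟦ Γ ⟧* W ⊆ ⟦ Δ ⟧* W
  ⟦⟧*-↭ W Perm.refl m∈ = m∈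
  ⟦⟧*-↭ W (Perm.prep A π) (x , y , x∈ , y∈ , m≈) = x , y , x∈ , ⟦⟧*-↭ W π y∈ , m≈
  ⟦⟧*-↭ W (Perm.swap A B π) (x , z , x∈ , (y , w , y∈ , w∈ , z≈) , m≈) =
    y , x ∙ w , y∈ , (x , w , x∈ , ⟦⟧*-↭ W π w∈ , M.refl) ,
    M.trans m≈ (M.trans (M.∙-congˡ z≈) (x∙yz≈y∙xz x y w))
  ⟦⟧*-↭ W (Perm.trans π π′) m∈ = ⟦⟧*-↭ W π′ (⟦⟧*-↭ W π m∈)

  ⟦[]⟧* : ∀ A W → ⟦ A ⟧ W ⊆ ⟦ [ A ] ⟧* W
  ⟦[]⟧* A W {m} m∈ = m , ε , m∈ , lift M.refl , M.sym (M.identityʳ m)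

  module _ (admissible : Admissible) where

    -- Fixed points in admissible models.

    value : Formula → Value
    value A = proj₁ (admissible A) , proj₁ (proj₂ (admissible A))

    ≐-value : ∀ A → ⟦ A ⟧ V ≐ proj₁ (value A)
    ≐-value A = proj₂ (proj₂ (admissible A))

    ⟦[0↦]⟧-value : ∀ A F → ⟦ A [0↦ F ] ⟧ V ≐ ⟦ A ⟧ (V [0↦ value F ]ᵛ)
    ⟦[0↦]⟧-value A F = ⟦[0↦]⟧ A F V (value F) (≐-value F)

    -- The fixed point lies below each prefixed point `X`, so by monotonicity its image under `A`
    -- lies below that of `X`, which is contained in `X`.
    μ-fold : ∀ A .(p : Positive 0 A) → ⟦ A [0↦ μ A p ] ⟧ V ⊆ ⟦ μ A p ⟧ V
    μ-fold A p m∈ X (X∈𝒟 , AX⊆X) =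
      AX⊆X (⟦⟧-mono₀ A p V (value (μ A p)) (X , X∈𝒟)
        (λ y∈ → proj₂ (≐-value (μ A p)) y∈ X (X∈𝒟 , AX⊆X))
        (proj₁ (⟦[0↦]⟧-value A (μ A p)) m∈))

    μ-least : ∀ A .(p : Positive 0 A) S → ⟦ A [0↦ S ] ⟧ V ⊆ ⟦ S ⟧ V → ⟦ μ A p ⟧ V ⊆ ⟦ S ⟧ V
    -- By admissibility `S` denotes a member of `𝒟`, and the premise makes it one of the prefixed
    -- points intersected.
    μ-least A p S AS⊆S m∈ = proj₂ (≐-value S) (m∈ _ (proj₂ (value S) , λ y∈ →
      proj₁ (≐-value S) (AS⊆S (proj₂ (⟦[0↦]⟧-value A S) y∈))))

    ν-greatest : ∀ A .(p : Positive 0 A) S → ⟦ S ⟧ V ⊆ ⟦ A [0↦ S ] ⟧ V → ⟦ S ⟧ V ⊆ ⟦ ν A p ⟧ V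
    ν-greatest A p S S⊆AS m∈ = ⊆-cl (proj₁ (value S) , (proj₂ (value S) , λ {_} y∈ →
      proj₁ (⟦[0↦]⟧-value A S) (S⊆AS (proj₂ (≐-value S) y∈))) , proj₁ (≐-value S) m∈)

    -- The right side is closed, so a single postfixed point `X` suffices; it lies below the
    -- greatest fixed point, and monotonicity carries `X` ⊆ A(X) to the unfolding.
    ν-unfold : ∀ A .(p : Positive 0 A) → ⟦ ν A p ⟧ V ⊆ ⟦ A [0↦ ν A p ] ⟧ V
    ν-unfold A p = cl-least (⟦⟧-closed (A [0↦ ν A p ]) V) λ where
      (X , (X∈𝒟 , X⊆AX) , m∈X) → proj₂ (⟦[0↦]⟧-value A (ν A p))
        (⟦⟧-mono₀ A p V (X , X∈𝒟) (value (ν A p))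
          (λ x∈X → proj₁ (≐-value (ν A p)) (⊆-cl (X , (X∈𝒟 , λ {_} → X⊆AX) , x∈X)))
          (X⊆AX m∈X))

    -- Soundness of the rules.

    soundness : ∀ {Γ C} → Γ ⊢ C → ⟦ Γ ⟧* V ⊆ ⟦ C ⟧ V

    -- Removes the trailing factor {1} from the antecedent, for the invariant premises of `μ⊢` and
    -- `⊢ν`.
    soundness₁ : ∀ {A C} → [ A ] ⊢ C → ⟦ A ⟧ V ⊆ ⟦ C ⟧ V
    soundness₁ {A} π m∈ = soundness π (⟦[]⟧* A V m∈)

    soundness (exchange π d) m∈ = soundness d (⟦⟧*-↭ V (Perm.↭-sym π) m∈)
    soundness (ax {A}) (x , y , x∈ , lift y≈ε , m≈) =
      ⟦⟧-resp-≈ A V (M.sym (M.trans m≈ (M.trans (M.∙-congˡ y≈ε) (M.identityʳ x)))) x∈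
    soundness (cut {Γ} {Δ} d e) m∈ with ⟦++⟧* Γ Δ V m∈
    ... | g , d′ , g∈ , d∈ , m≈ = soundness e (g , d′ , soundness d g∈ , d∈ , m≈)
    soundness ⊢𝟏 (lift m≈ε) = ⊆-cl m≈ε
    soundness (𝟏⊢ {Γ} {C} d) (x , y , x∈ , y∈ , m≈) =
      ⟦⟧-resp-≈ C V (M.sym m≈) (cl-∙-least (⟦⟧-closed C V) y
        (λ {x} x≈ε → soundness d (⟦⟧*-resp-≈ Γ V
          (M.sym (M.trans (M.∙-congʳ x≈ε) (M.identityˡ y))) y∈)) x∈)
    soundness ⊢⊤ m∈ = _
    soundness (𝟎⊢ {C = C}) (x , y , x∈ , y∈ , m≈) =
      -- The closure of ∅ has no generators to check.
      ⟦⟧-resp-≈ C V (M.sym m≈) (cl-∙-least {X = ∅} (⟦⟧-closed C V) y (λ ()) x∈)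
    soundness (⊢⊗ {Γ} {Δ} d e) m∈ =
      ⊆-cl (·-mono (soundness d) (soundness e) (⟦++⟧* Γ Δ V m∈))
    soundness (⊗⊢ {C = C} d) (x , y , x∈ , y∈ , m≈) =
      ⟦⟧-resp-≈ C V (M.sym m≈) (cl-∙-least (⟦⟧-closed C V) y
        (λ (u , v , u∈ , v∈ , x≈) → soundness d
          (u , v ∙ y , u∈ , (v , y , v∈ , y∈ , M.refl) ,
           M.trans (M.∙-congʳ x≈) (M.assoc u v y))) x∈)
    soundness (⊢& d e) m∈ = soundness d m∈ , soundness e m∈
    soundness (&⊢₀ d) (x , y , (x∈ , _) , y∈ , m≈) = soundness d (x , y , x∈ , y∈ , m≈)
    soundness (&⊢₁ d) (x , y , (_ , x∈) , y∈ , m≈) = soundness d (x , y , x∈ , y∈ , m≈)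
    soundness (⊢⊕₀ d) m∈ = ⊆-cl (inj₁ (soundness d m∈))
    soundness (⊢⊕₁ d) m∈ = ⊆-cl (inj₂ (soundness d m∈))
    soundness (⊕⊢ {C = C} d e) (x , y , x∈ , y∈ , m≈) =
      ⟦⟧-resp-≈ C V (M.sym m≈) (cl-∙-least (⟦⟧-closed C V) y
        (λ { (inj₁ u∈) → soundness d (_ , y , u∈ , y∈ , M.refl)
           ; (inj₂ u∈) → soundness e (_ , y , u∈ , y∈ , M.refl) }) x∈)
    soundness (⊢⊸ d) {m} m∈ x x∈ = soundness d (x , m , x∈ , m∈ , M.refl)
    soundness (⊸⊢ {Γ} {Δ} d e) (f , y , f∈ , y∈ , m≈) with ⟦++⟧* Γ Δ V y∈
    ... | g , d′ , g∈ , d∈ , y≈ = soundness e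
      -- `⊸ˢ` multiplies by its argument on the left, so the product f(gd′) is regrouped as (gf)d′.
      (g ∙ f , d′ , f∈ g (soundness d g∈) , d∈ ,
       M.trans m≈ (M.trans (M.∙-congˡ y≈)
         (M.trans (M.sym (M.assoc f g d′)) (M.∙-congʳ (M.comm f g)))))
    soundness (⊢μ {A = A} {p} d) m∈ = μ-fold A p (soundness d m∈)
    soundness (μ⊢ {A = A} {p = p} S d e) m∈ =
      soundness e (·-mono (μ-least A p S (soundness₁ d)) id m∈)
    soundness (⊢ν {A = A} {p} S d e) m∈ = ν-greatest A p S (soundness₁ e) (soundness d m∈)
    soundness (ν⊢ {A = A} {p = p} d) m∈ = soundness d (·-mono (ν-unfold A p) id m∈)

lemma4p4 : ∀ (ℓ : Level) →
    (∀ (Γ : List Formula) (C : Formula) → Γ ⊢ C →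
    ∀ (𝓜 : μPhaseModel ℓ) → let open μPhaseModel 𝓜 in Admissible →
    ⟦ Γ ⟧* V ⊆ ⟦ C ⟧ V)
    ×
    (∀ (A : Formula) → [] ⊢ A →
    ∀ (𝓜 : μPhaseModel ℓ) → let open μPhaseModel 𝓜 in Admissible →
    True A)
lemma4p4 ℓ =
  (λ Γ C d 𝓜 adm → Semantics.soundness 𝓜 adm d) ,
  -- The unit belongs to the empty product {1}, so truth is the case of an empty antecedent.
  (λ A d 𝓜 adm → Semantics.soundness 𝓜 adm d
    (lift (Semantics.M.refl 𝓜)))
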